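{- For every integer $n \geq 6$, $$\gamma_{b,2}(C_6 \square C_n) = n + \begin{cases} 0 & \text{if } n \equiv 0 \pmod 4,\\ 1 & \text{if } n \equiv 1, 2, \text{ or } 3 \pmod 4.\end{cases}$$
   Context: For a graph $G$, a $2$-limited broadcast is a function $f: V(G) \to \{0,1,2\}$. A vertex $u$ hears the broadcast from $v$ if $f(v) > 0$ and $d(u,v) \leq f(v)$, where $d$ is the distance in $G$. The broadcast $f$ is dominating if every vertex of $G$ hears the broadcast from some vertex. The cost of $f$ is $\sum_{v \in V(G)} f(v)$. The $2$-limited broadcast domination number $\gamma_{b,2}(G)$ is the minimum cost of a $2$-limited dominating broadcast on $G$. $C_n$ denotes the cycle on $n$ vertices and $\square$ the Cartesian product of graphs. -}

module Defs where

open import Data.Fin using (Fin; toℕ)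
open import Data.Fin.Properties using (*↔×)
open import Data.Nat using (ℕ; suc; _*_; _≤_; _>_; s≤s)
open import Data.Nat.Properties using (+-0-commutativeMonoid; 1+n≢n)
open import Data.Product using (∃-syntax; _×_; _,_)
open import Data.Product.Function.NonDependent.Propositional using (_×-↔_)
open import Data.Sum using (_⊎_; inj₁; inj₂)
open import Function using (_↔_; Inverse)
open import Function.Construct.Composition using (_↔-∘_)
open import Function.Construct.Identity using (↔-id)
open import Function.Construct.Symmetry using (↔-sym)
open import Relation.Binary using (Symmetric; Irreflexive)
open import Relation.Binary.Construct.Closure.Symmetric using (SymClosure; fwd; bwd)
import Relation.Binary.Construct.Closure.Symmetric as SymClosure
open import Relation.Binary.PropositionalEquality using (_≡_; refl; sym; trans; cong)
import Algebra.Properties.CommutativeMonoid.Sum as CommutativeMonoidSum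

open CommutativeMonoidSum +-0-commutativeMonoid using (sum)

record Graph : Set₁ where
  infix 4 _~_
  field
    V        : Set
    order    : ℕ
    finite   : V ↔ Fin order
    _~_      : V → V → Set
    ~-sym    : Symmetric _~_
    ~-irrefl : Irreflexive _≡_ _~_

module _ {n : ℕ} where

  data Next (i j : Fin n) : Set where
    step : toℕ j ≡ suc (toℕ i) → Next i j
    wrap : suc (toℕ i) ≡ n → toℕ j ≡ 0 → Next i j

  -- For n = 1 the wrap-around edge would be a loop.
  Next-irrefl : 3 ≤ n → Irreflexive _≡_ Next
  Next-irrefl _ refl (step eq) = 1+n≢n (sym eq)
  Next-irrefl (s≤s (s≤s _)) refl (wrap p q) with trans (sym p) (cong suc q)
  ... | ()

cycle : ∀ n → 3 ≤ n → Graph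
cycle n 3≤n = record
  { V        = Fin n
  ; order    = n
  ; finite   = ↔-id (Fin n)
  ; _~_      = SymClosure Next
  ; ~-sym    = SymClosure.symmetric Next
  ; ~-irrefl = λ where
      eq (fwd p) → Next-irrefl 3≤n eq p
      eq (bwd p) → Next-irrefl 3≤n (sym eq) p
  }

infixr 5 _□_

_□_ : Graph → Graph → Graph
G □ H = record
  { V        = G.V × H.V
  ; order    = G.order * H.order
  ; finite   = ↔-sym *↔× ↔-∘ (G.finite ×-↔ H.finite)
  ; _~_      = λ (u , v) (u′ , v′) →
                 (u ≡ u′ × v H.~ v′) ⊎ (u G.~ u′ × v ≡ v′)
  ; ~-sym    = λ where
      (inj₁ (eq , e)) → inj₁ (sym eq , H.~-sym e)
      (inj₂ (e , eq)) → inj₂ (G.~-sym e , sym eq)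
  ; ~-irrefl = λ where
      refl (inj₁ (_ , e)) → H.~-irrefl refl e
      refl (inj₂ (e , _)) → G.~-irrefl refl e
  }
  where
  module G = Graph G
  module H = Graph H

IsMinimum : (ℕ → Set) → ℕ → Set
IsMinimum P m = P m × (∀ k → P k → m ≤ k)

module _ (G : Graph) where
  open Graph G

  data Walk : V → V → ℕ → Set where
    []  : ∀ {u} → Walk u u 0
    _∷_ : ∀ {u v w k} → u ~ v → Walk v w k → Walk u w (suc k)

  -- A relation rather than a function: it holds for no d when u and v lie
  -- in different components, i.e. when the distance is infinite.
  IsDistance : V → V → ℕ → Set
  IsDistance u v = IsMinimum (Walk u v)

  Broadcast : Set
  Broadcast = V → Fin 3

  Hears : Broadcast → V → V → Set
  Hears f u v = toℕ (f v) > 0 × ∃[ d ] (IsDistance u v d × d ≤ toℕ (f v))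

  Dominating : Broadcast → Set
  Dominating f = ∀ u → ∃[ v ] Hears f u v

  cost : Broadcast → ℕ
  cost f = sum (λ i → toℕ (f (Inverse.from finite i)))

  -- Is2LimitedBroadcastNumber m reads γ_{b,2}(G) = m; such an m is unique,
  -- by antisymmetry of ≤.
  Is2LimitedBroadcastNumber : ℕ → Set
  Is2LimitedBroadcastNumber = IsMinimum (λ c → ∃[ f ] (Dominating f × cost f ≡ c))

{-# OPTIONS --safe #-}
module Submission where

-- Lower bound.  Call the sum of f over a column its weight.  A column can only be dominated if the
-- weights of the five columns around it are large enough (6 ≤ own + adj + adj + far + far, for
-- explicit functions of the weight).  A discharging argument over these windows of five weights shows
-- that the average weight is at least 1, and that average 1 forces the weights 2,0,2,0,… .  In that
-- case every column of weight 2 holds a single 2, and a column of weight 0 is dominated only if the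
-- 2s on its two sides sit in opposite rows, so the broadcast repeats with period exactly 4.
--
-- Upper bound.  The same staggered pattern of 2s works when 4 ∣ n.  Otherwise it is preceded by one
-- block of 5, 6 or 7 columns whose cost exceeds its length by one.

open import Defs
import Algebra.Properties.CommutativeMonoid.Sum as CommutativeMonoidSum
open import Data.Bool using (true; false; _∨_; if_then_else_)
open import Data.Fin using (Fin; zero; suc; toℕ; #_; fromℕ<; _↑ˡ_; _↑ʳ_; combine)
open import Data.Fin.Properties using (all?; any?; toℕ-injective; toℕ<n; toℕ-fromℕ<; remQuot-combine)
  renaming (_≟_ to _≟ᶠ_)
open import Data.Nat
open import Data.Nat.DivMod
open import Data.Nat.Properties
open import Data.Product using (_×_; _,_; ∃-syntax; proj₁; proj₂)
open import Data.Sum using (_⊎_; inj₁; inj₂; [_,_]′)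
import Data.Vec as Vec
open import Data.Vec using (Vec; []; _∷_; lookup; tabulate; replicate; _[_]≔_)
open import Data.Vec.Properties using (lookup∘tabulate)
open import Function using (_∘_; id; Inverse)
open import Relation.Binary.Construct.Closure.Symmetric using (SymClosure; fwd; bwd)
open import Relation.Binary.PropositionalEquality
  using (_≡_; _≢_; refl; sym; trans; cong; cong₂; subst; subst₂; module ≡-Reasoning)
open import Relation.Nullary using (Dec; does; ¬_; ¬?; yes; no; contradiction)
open import Relation.Nullary.Decidable using (map′; toWitness; _×-dec_; _⊎-dec_; _→-dec_)
open import Relation.Unary using (Decidable)
open CommutativeMonoidSum +-0-commutativeMonoid using (sum; ∑-distrib-+; ∑-comm; sum-cong-≗)

-- Discharging on column weights

-- The weight of a column, where 6 stands for "at least 6".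
Class : Set
Class = Fin 7

-- Upper bounds for the number of vertices of a column that hear a column of the given class at
-- distance 0, 1 or 2.
own adj far : Class → ℕ
own = lookup (0 ∷ 3 ∷ 6 ∷ 6 ∷ 6 ∷ 6 ∷ 6 ∷ [])
adj = lookup (0 ∷ 1 ∷ 3 ∷ 4 ∷ 6 ∷ 6 ∷ 6 ∷ [])
far = lookup (0 ∷ 0 ∷ 1 ∷ 1 ∷ 2 ∷ 2 ∷ 6 ∷ [])

-- flow w x is the charge that a column of class x with predecessor of class w hands on to its
-- successor.  The constants are a solution, found by computer, of the inequalities in discharge.
flow : Class → Class → ℕ
flow w zero      = lookup (1 ∷ 1 ∷ 0 ∷ 2 ∷ 7 ∷ 16 ∷ 27 ∷ []) w
flow w x@(suc _) = lookup (0 ∷ 2 ∷ 10 ∷ 19 ∷ 29 ∷ 39 ∷ 49 ∷ []) x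
                 + lookup (0 ∷ 1 ∷ 5 ∷ 14 ∷ 24 ∷ 34 ∷ 44 ∷ []) w

Covered : (p q r s t : Class) → Set
Covered p q r s t = 6 ≤ own r + (adj q + (adj s + (far p + far t)))

-- Twenty times the weight of the middle column plus its incoming charge, against the average weight 1
-- plus its outgoing charge; flow is used in both directions.
before after : (p q r s t : Class) → ℕ
before p q r s t = 20 * toℕ r + (flow p q + flow t s)
after  p q r s t = 20 + (flow q r + flow s r)

opaque
  -- Evaluation over all 7^5 windows; capping weights at 6 keeps this finite. The strict inequality
  -- outside two alternating windows is what later makes the equality case rigid.
  discharge : ∀ p q r s t → Covered p q r s t →
    after p q r s t < before p q r s t ⊎
    (p ≡ # 2 × q ≡ # 0 × r ≡ # 2 × s ≡ # 0 × t ≡ # 2) ⊎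
    (p ≡ # 0 × q ≡ # 2 × r ≡ # 0 × s ≡ # 2 × t ≡ # 0)
  discharge = toWitness {a? = all? λ p → all? λ q → all? λ r → all? λ s → all? λ t →
    (6 ≤? own r + (adj q + (adj s + (far p + far t)))) →-dec
    (after p q r s t <? before p q r s t ⊎-dec
     ((p ≟ᶠ # 2 ×-dec q ≟ᶠ # 0 ×-dec r ≟ᶠ # 2 ×-dec s ≟ᶠ # 0 ×-dec t ≟ᶠ # 2) ⊎-dec
      (p ≟ᶠ # 0 ×-dec q ≟ᶠ # 2 ×-dec r ≟ᶠ # 0 ×-dec s ≟ᶠ # 2 ×-dec t ≟ᶠ # 0)))} _

after≤before : ∀ p q r s t → Covered p q r s t → after p q r s t ≤ before p q r s t
after≤before p q r s t c with discharge p q r s t c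
... | inj₁ lt                                        = <⇒≤ lt
-- In the alternating windows both sides evaluate to the same numeral, 40 in the first and 20 in the
-- second.
... | inj₂ (inj₁ (refl , refl , refl , refl , refl)) = ≤-refl
... | inj₂ (inj₂ (refl , refl , refl , refl , refl)) = ≤-refl

-- Single columns

Column : Set
Column = Vec (Fin 3) 6

Row : Set
Row = Fin 6

weight : Column → ℕ
weight v = sum λ r → toℕ (lookup v r)

opaque
  class : Column → Class
  class v = fromℕ< (s≤s (m⊓n≤n (weight v) 6))

  class≤weight : ∀ v → toℕ (class v) ≤ weight v
  class≤weight v = ≤-trans (≤-reflexive (toℕ-fromℕ< _)) (m⊓n≤m (weight v) 6)

-- The distance in C_6: the length of the shorter arc.
rowDist : Row → Row → ℕ
rowDist r s = ∣ toℕ r - toℕ s ∣ ⊓ (6 ∸ ∣ toℕ r - toℕ s ∣)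

-- `d` is the distance along C_n from the listener's column to the column `v`, and `r` is the
-- listener's row.
Heard : ℕ → Column → Row → Set
Heard d v r = ∃[ s ] 0 < toℕ (lookup v s) × rowDist r s + d ≤ toℕ (lookup v s)

heard? : ∀ d v → Decidable (Heard d v)
heard? d v r = any? λ s → 0 <? toℕ (lookup v s) ×-dec rowDist r s + d ≤? toℕ (lookup v s)

opaque
  count : ∀ {n} {P : Fin n → Set} → Decidable P → ℕ
  count P? = sum λ i → if does (P? i) then 1 else 0

allVec? : ∀ {k n} {P : Vec (Fin k) n → Set} → Decidable P → Dec (∀ v → P v)
allVec? {n = zero}  P? = map′ (λ { p [] → p }) (λ p → p []) (P? [])
allVec? {n = suc n} P? =
  map′ (λ { p (x ∷ v) → p x v }) (λ p x v → p (x ∷ v)) (all? λ x → allVec? λ v → P? (x ∷ v))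

rotate : ℕ → Row → Row
rotate k r = (k + toℕ r) mod 6

opaque
  unfolding class count

  -- Enumeration of all 3^6 columns; this is what justifies the tables `own`, `adj` and `far`.
  count-heard : ∀ v → count (heard? 0 v) ≤ own (class v) ×
                      count (heard? 1 v) ≤ adj (class v) ×
                      count (heard? 2 v) ≤ far (class v)
  count-heard = toWitness {a? = allVec? λ v →
    count (heard? 0 v) ≤? own (class v) ×-dec
    count (heard? 1 v) ≤? adj (class v) ×-dec
    count (heard? 2 v) ≤? far (class v)} _

  class-0-deaf : ∀ v → class v ≡ # 0 → ∀ r → ¬ Heard 0 v r
  class-0-deaf = toWitness {a? = allVec? λ v → (class v ≟ᶠ # 0) →-dec
    all? λ r → ¬? (heard? 0 v r)} _

  -- The alternative is two 1s, and a 1 reaches only its own row in an adjacent column.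
  class-2-has-2 : ∀ v → class v ≡ # 2 → 3 ≤ count (heard? 1 v) → ∃[ r ] lookup v r ≡ # 2
  class-2-has-2 = toWitness {a? = allVec? λ v → (class v ≟ᶠ # 2) →-dec
    (3 ≤? count (heard? 1 v)) →-dec any? λ r → lookup v r ≟ᶠ # 2} _

  -- The 2 uses up the whole weight, and in an adjacent column it reaches only row `r` and the two
  -- rows next to it.
  unheard-opposite : ∀ v → class v ≡ # 2 → ∀ r → lookup v r ≡ # 2 →
    ¬ Heard 1 v (rotate 2 r) × ¬ Heard 1 v (rotate 3 r) × ¬ Heard 1 v (rotate 4 r) ×
    lookup v (rotate 3 r) ≢ # 2
  unheard-opposite = toWitness {a? = allVec? λ v → (class v ≟ᶠ # 2) →-dec all? λ r →
    (lookup v r ≟ᶠ # 2) →-dec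
    ¬? (heard? 1 v (rotate 2 r)) ×-dec ¬? (heard? 1 v (rotate 3 r)) ×-dec
    ¬? (heard? 1 v (rotate 4 r)) ×-dec ¬? (lookup v (rotate 3 r) ≟ᶠ # 2)} _

  -- Two 1s would reach only two rows of an adjacent column, so the weight is a single 2, and the
  -- three rows it reaches are centred at its own.
  heard-from-middle : ∀ v → class v ≡ # 2 → ∀ r →
    Heard 1 v (rotate 2 r) → Heard 1 v (rotate 3 r) → Heard 1 v (rotate 4 r) →
    lookup v (rotate 3 r) ≡ # 2
  heard-from-middle = toWitness {a? = allVec? λ v → (class v ≟ᶠ # 2) →-dec all? λ r →
    heard? 1 v (rotate 2 r) →-dec heard? 1 v (rotate 3 r) →-dec heard? 1 v (rotate 4 r) →-dec
    (lookup v (rotate 3 r) ≟ᶠ # 2)} _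

next? : ∀ {n} (i j : Fin n) → Dec (Next i j)
next? {n} i j = map′
  (λ { (inj₁ p) → step p ; (inj₂ (p , q)) → wrap p q })
  (λ { (step p) → inj₁ p ; (wrap p q) → inj₂ (p , q) })
  (toℕ j ≟ suc (toℕ i) ⊎-dec (suc (toℕ i) ≟ n ×-dec toℕ j ≟ 0))

opaque
  rotate-3-involutive : ∀ r → rotate 3 (rotate 3 r) ≡ r
  rotate-3-involutive = toWitness {a? = all? λ r → rotate 3 (rotate 3 r) ≟ᶠ r} _

  rowDist-next : ∀ r s → Next r s → ∀ t →
    rowDist r t ≤ suc (rowDist s t) × rowDist s t ≤ suc (rowDist r t)
  rowDist-next = toWitness {a? = all? λ r → all? λ s → next? r s →-dec all? λ t →
    (rowDist r t ≤? suc (rowDist s t)) ×-dec (rowDist s t ≤? suc (rowDist r t))} _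

  rowDist-refl : ∀ r → rowDist r r ≡ 0
  rowDist-refl = toWitness {a? = all? λ r → rowDist r r ≟ 0} _

-- Sums and counting

sum-mono-≤ : ∀ {n} {g h : Fin n → ℕ} → (∀ i → g i ≤ h i) → sum g ≤ sum h
sum-mono-≤ {zero}  p = z≤n
sum-mono-≤ {suc n} p = +-mono-≤ (p zero) (sum-mono-≤ (p ∘ suc))

-- Equal totals leave no slack in any term. This passes from a broadcast of cost `n` to equality in
-- each window.
sum-mono-tight : ∀ {n} {g h : Fin n → ℕ} → (∀ i → g i ≤ h i) → sum h ≤ sum g → ∀ i → h i ≤ g i
sum-mono-tight {suc n} {g} {h} p q zero = +-cancelʳ-≤ (sum (g ∘ suc)) (h zero) (g zero)
  (≤-trans (+-monoʳ-≤ (h zero) (sum-mono-≤ (p ∘ suc))) q)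
sum-mono-tight {suc n} {g} {h} p q (suc i) = sum-mono-tight (p ∘ suc)
  (+-cancelˡ-≤ (g zero) _ _ (≤-trans (+-monoˡ-≤ (sum (h ∘ suc)) (p zero)) q)) i

sum-const : ∀ n c → sum {n} (λ _ → c) ≡ n * c
sum-const zero    c = refl
sum-const (suc n) c = cong (c +_) (sum-const n c)

sum-*ˡ : ∀ {n} c (g : Fin n → ℕ) → sum (λ i → c * g i) ≡ c * sum g
sum-*ˡ {zero}  c g = sym (*-zeroʳ c)
sum-*ˡ {suc n} c g = trans (cong (c * g zero +_) (sum-*ˡ c (g ∘ suc)))
  (sym (*-distribˡ-+ c (g zero) _))

∑< : ℕ → (ℕ → ℕ) → ℕ
∑< n g = sum {n} (g ∘ toℕ)

∑<-suc : ∀ n g → ∑< (suc n) g ≡ ∑< n g + g n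
∑<-suc zero    g = +-identityʳ _
∑<-suc (suc n) g = trans (cong (g 0 +_) (∑<-suc n (g ∘ suc))) (sym (+-assoc (g 0) _ _))

∑<-shift : ∀ n g → g n ≡ g 0 → ∑< n (g ∘ suc) ≡ ∑< n g
∑<-shift n g eq = +-cancelˡ-≡ (g 0) _ _ (begin
  ∑< (suc n) g   ≡⟨ ∑<-suc n g ⟩
  ∑< n g + g n   ≡⟨ +-comm _ (g n) ⟩
  g n + ∑< n g   ≡⟨ cong (_+ ∑< n g) eq ⟩
  g 0 + ∑< n g   ∎)
  where open ≡-Reasoning

module _ {n} {P : Fin n → Set} (P? : Decidable P) where

  opaque
    unfolding count

    count-all : (∀ i → P i) → n ≤ count P?
    count-all p = subst (_≤ count P?) (trans (sum-const n 1) (*-identityʳ n)) (sum-mono-≤ one)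
      where
      one : ∀ i → 1 ≤ (if does (P? i) then 1 else 0)
      one i with P? i
      ... | yes _ = ≤-refl
      ... | no ¬p = contradiction (p i) ¬p

    count-⊎ : {Q : Fin n → Set} (Q? : Decidable Q) →
      count (λ i → P? i ⊎-dec Q? i) ≤ count P? + count Q?
    count-⊎ Q? = subst (count (λ i → P? i ⊎-dec Q? i) ≤_) (∑-distrib-+ {n} _ _)
      (sum-mono-≤ λ i → le (does (P? i)) (does (Q? i)))
      where
      le : ∀ a b → (if a ∨ b then 1 else 0) ≤ (if a then 1 else 0) + (if b then 1 else 0)
      le true  b = s≤s z≤n
      le false b = ≤-refl

-- Walks

module _ {G H : Graph} where
  private
    module G = Graph G
    module H = Graph H

  walk-□ : ∀ {u u′ v v′ a b} → Walk G u u′ a → Walk H v v′ b →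
    Walk (G □ H) (u , v) (u′ , v′) (a + b)
  walk-□ []      []      = []
  walk-□ []      (e ∷ w) = inj₁ (refl , e) ∷ walk-□ [] w
  walk-□ (e ∷ u) w       = inj₂ (e , refl) ∷ walk-□ u w

  walk-□⁻ : ∀ {u u′ v v′ d} → Walk (G □ H) (u , v) (u′ , v′) d →
    ∃[ a ] ∃[ b ] Walk G u u′ a × Walk H v v′ b × a + b ≡ d
  walk-□⁻ [] = 0 , 0 , [] , [] , refl
  walk-□⁻ (inj₁ (refl , e) ∷ w) with walk-□⁻ w
  ... | a , b , p , q , eq = a , suc b , p , e ∷ q , trans (+-suc a b) (cong suc eq)
  walk-□⁻ (inj₂ (e , refl) ∷ w) with walk-□⁻ w
  ... | a , b , p , q , eq = suc a , b , e ∷ p , q , cong suc eq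

module _ {G : Graph} where
  open Graph G

  walk-snoc : ∀ {u v w k} → Walk G u v k → v ~ w → Walk G u w (suc k)
  walk-snoc []      e = e ∷ []
  walk-snoc (d ∷ p) e = d ∷ walk-snoc p e

  walk-reverse : ∀ {u v k} → Walk G u v k → Walk G v u k
  walk-reverse []      = []
  walk-reverse (e ∷ p) = walk-snoc (walk-reverse p) (~-sym e)

  -- `Hears` asks for an exact distance where only a walk is at hand. After equality and adjacency
  -- are excluded every walk has length at least 2, so the given one is shortest.
  distance-≤2 : (∀ u v → Dec (u ≡ v)) → (∀ u v → Dec (u ~ v)) →
    ∀ {u v k} → Walk G u v k → k ≤ 2 → ∃[ d ] IsDistance G u v d × d ≤ k
  distance-≤2 _≟ᵛ_ _~?_ {u} {v} {k} p k≤2 with u ≟ᵛ v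
  ... | yes refl = 0 , ([] , λ _ _ → z≤n) , z≤n
  ... | no u≢v with u ~? v
  ...   | yes e = 1 , (e ∷ [] , λ { _ [] → contradiction refl u≢v ; _ (_ ∷ _) → s≤s z≤n }) , pos p
    where
    pos : ∀ {k} → Walk G u v k → 1 ≤ k
    pos []      = contradiction refl u≢v
    pos (_ ∷ _) = s≤s z≤n
  ...   | no ¬e = k , (p , λ _ q → ≤-trans k≤2 (two q)) , ≤-refl
    where
    two : ∀ {k} → Walk G u v k → 2 ≤ k
    two []          = contradiction refl u≢v
    two (e ∷ [])    = contradiction e ¬e
    two (_ ∷ _ ∷ _) = s≤s (s≤s z≤n)

rowDist-walk : ∀ {3≤6 r s k} → Walk (cycle 6 3≤6) r s k → rowDist r s ≤ k
rowDist-walk {r = r} [] = ≤-reflexive (rowDist-refl r)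
rowDist-walk {3≤6} {s = s} (fwd e ∷ w) =
  ≤-trans (proj₁ (rowDist-next _ _ e s)) (s≤s (rowDist-walk {3≤6} w))
rowDist-walk {3≤6} {s = s} (bwd e ∷ w) =
  ≤-trans (proj₂ (rowDist-next _ _ e s)) (s≤s (rowDist-walk {3≤6} w))

-- Cycles as quotients of ℕ

module _ (n : ℕ) .{{_ : NonZero n}} where

  mod-toℕ : (j : Fin n) → toℕ j mod n ≡ j
  mod-toℕ j = toℕ-injective (trans (toℕ-fromℕ< _) (m<n⇒m%n≡m (toℕ<n j)))

  mod-cong : ∀ {i j} → i % n ≡ j % n → i mod n ≡ j mod n
  mod-cong eq = toℕ-injective (trans (toℕ-fromℕ< _) (trans eq (sym (toℕ-fromℕ< _))))

  %-congʳ-+ : ∀ k {i j} → i % n ≡ j % n → (k + i) % n ≡ (k + j) % n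
  %-congʳ-+ k {i} {j} eq = begin
    (k + i) % n          ≡⟨ %-distribˡ-+ k i n ⟩
    (k % n + i % n) % n  ≡⟨ cong (λ x → (k % n + x) % n) eq ⟩
    (k % n + j % n) % n  ≡⟨ %-distribˡ-+ k j n ⟨
    (k + j) % n          ∎
    where open ≡-Reasoning

  suc-% : ∀ i → suc i % n ≡ suc (i % n) % n
  suc-% i = %-congʳ-+ 1 (sym (m%n%n≡m%n i n))

  next-mod : ∀ i → Next (i mod n) (suc i mod n)
  next-mod i with m≤n⇒m<n∨m≡n (m%n<n i n)
  ... | inj₁ lt = step (begin
    toℕ (suc i mod n)      ≡⟨ toℕ-fromℕ< _ ⟩
    suc i % n              ≡⟨ suc-% i ⟩
    suc (i % n) % n        ≡⟨ m<n⇒m%n≡m lt ⟩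
    suc (i % n)            ≡⟨ cong suc (toℕ-fromℕ< _) ⟨
    suc (toℕ (i mod n))    ∎)
    where open ≡-Reasoning
  ... | inj₂ eq = wrap (trans (cong suc (toℕ-fromℕ< _)) eq) (begin
    toℕ (suc i mod n)      ≡⟨ toℕ-fromℕ< _ ⟩
    suc i % n              ≡⟨ suc-% i ⟩
    suc (i % n) % n        ≡⟨ cong (_% n) eq ⟩
    n % n                  ≡⟨ n%n≡0 n ⟩
    0                      ∎)
    where open ≡-Reasoning

module _ {n : ℕ} where

  next-functional : {u v w : Fin n} → Next u v → Next u w → v ≡ w
  next-functional (step p)   (step q)    = toℕ-injective (trans p (sym q))
  next-functional {v = v} (step p) (wrap q _) = contradiction (trans p q) (<⇒≢ (toℕ<n v))
  next-functional {w = w} (wrap p _) (step q) = contradiction (trans q p) (<⇒≢ (toℕ<n w))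
  next-functional (wrap _ p) (wrap _ q)  = toℕ-injective (trans p (sym q))

  next-injective : {u v w : Fin n} → Next u w → Next v w → u ≡ v
  next-injective (step p)   (step q)   = toℕ-injective (suc-injective (trans (sym p) q))
  next-injective (step p)   (wrap _ q) = contradiction (trans (sym p) q) 1+n≢0
  next-injective (wrap _ p) (step q)   = contradiction (trans (sym q) p) 1+n≢0
  next-injective (wrap p _) (wrap q _) = toℕ-injective (suc-injective (trans p (sym q)))

module _ (n : ℕ) (3≤n : 3 ≤ n) .{{_ : NonZero n}} where

  walk-mod : ∀ i k → Walk (cycle n 3≤n) (i mod n) ((k + i) mod n) k
  walk-mod i zero    = []
  walk-mod i (suc k) = walk-snoc (walk-mod i k) (fwd (next-mod n (k + i)))

  -- Centring at `suc i` names both neighbours without subtraction; windows are centred at `2 + i`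
  -- for the same reason.
  neighbour : ∀ i {v} → SymClosure Next (suc i mod n) v → v ≡ i mod n ⊎ v ≡ (2 + i) mod n
  neighbour i (fwd e) = inj₂ (next-functional e (next-mod n (suc i)))
  neighbour i (bwd e) = inj₁ (next-injective e (next-mod n i))

  -- The places that a walk of length b ≤ 2 from column 2 + i can reach.
  data Around (i : ℕ) : Fin n → ℕ → Set where
    same   : ∀ {b} → Around i ((2 + i) mod n) b
    left₁  : ∀ {b} → Around i ((1 + i) mod n) (1 + b)
    right₁ : ∀ {b} → Around i ((3 + i) mod n) (1 + b)
    left₂  : ∀ {b} → Around i (i mod n) (2 + b)
    right₂ : ∀ {b} → Around i ((4 + i) mod n) (2 + b)

  around : ∀ i {v b} → Walk (cycle n 3≤n) ((2 + i) mod n) v b → b ≤ 2 → Around i v b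
  around i [] _ = same
  around i (e ∷ []) _ with neighbour (1 + i) e
  ... | inj₁ refl = left₁
  ... | inj₂ refl = right₁
  around i (e ∷ e′ ∷ []) _ with neighbour (1 + i) e
  around i (e ∷ e′ ∷ []) _ | inj₁ refl with neighbour i e′
  ... | inj₁ refl = left₂
  ... | inj₂ refl = same
  around i (e ∷ e′ ∷ []) _ | inj₂ refl with neighbour (2 + i) e′
  ... | inj₁ refl = same
  ... | inj₂ refl = right₂
  around i (_ ∷ _ ∷ _ ∷ _) (s≤s (s≤s ()))

-- The cost as a sum over columns

sum-↑ : ∀ {m n} (g : Fin (m + n) → ℕ) →
  sum g ≡ sum (λ i → g (i ↑ˡ n)) + sum (λ i → g (m ↑ʳ i))
sum-↑ {zero}  g = refl
sum-↑ {suc m} g = trans (cong (g zero +_) (sum-↑ {m} (g ∘ suc))) (sym (+-assoc (g zero) _ _))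

sum-combine : ∀ {m n} (g : Fin (m * n) → ℕ) → sum g ≡ sum (λ i → sum λ j → g (combine {m} i j))
sum-combine {zero}      g = refl
sum-combine {suc m} {n} g = trans (sum-↑ {n} g)
  (cong (sum (λ i → g (i ↑ˡ m * n)) +_) (sum-combine {m} λ i → g (n ↑ʳ i)))

cost-□ : ∀ {m n} (3≤m : 3 ≤ m) (3≤n : 3 ≤ n) (f : Broadcast (cycle m 3≤m □ cycle n 3≤n)) →
  cost (cycle m 3≤m □ cycle n 3≤n) f ≡ sum λ j → sum λ i → toℕ (f (i , j))
cost-□ {m} {n} 3≤m 3≤n f = begin
  sum {m * n} (λ i → toℕ (f (from i)))
    ≡⟨ sum-combine {m} _ ⟩
  sum {m} (λ i → sum λ j → toℕ (f (from (combine i j))))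
    ≡⟨ sum-cong-≗ (λ i → sum-cong-≗ λ j → cong (λ v → toℕ (f v)) (remQuot-combine i j)) ⟩
  sum {m} (λ i → sum {n} λ j → toℕ (f (i , j)))
    ≡⟨ ∑-comm {m} {n} (λ i j → toℕ (f (i , j))) ⟩
  sum {n} (λ j → sum {m} λ i → toℕ (f (i , j))) ∎
  where
  open ≡-Reasoning
  open Inverse (Graph.finite (cycle m 3≤m □ cycle n 3≤n)) using (from)

-- Lower bound

heard-mono : ∀ {d d′ v r} → d ≤ d′ → Heard d′ v r → Heard d v r
heard-mono {r = r} d≤d′ (s , pos , le) = s , pos , ≤-trans (+-monoʳ-≤ (rowDist r s) d≤d′) le

-- A broadcast enters the lower bound only as an `n`-periodic sequence of columns indexed by ℕ, so
-- that windows need no modular arithmetic.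
module Columns (n : ℕ) .{{_ : NonZero n}}
  (column : ℕ → Column) (periodic : ∀ i → column (n + i) ≡ column i) where

  Listens : ℕ → Row → Set
  Listens i r = Heard 0 (column (2 + i)) r ⊎ Heard 1 (column (1 + i)) r ⊎ Heard 1 (column (3 + i)) r ⊎
                Heard 2 (column i) r ⊎ Heard 2 (column (4 + i)) r

  column-*n : ∀ q i → column (q * n + i) ≡ column i
  column-*n zero    i = refl
  column-*n (suc q) i = trans (cong column (+-assoc n (q * n) i)) (trans (periodic _) (column-*n q i))

  column-% : ∀ k i → column (k + i % n) ≡ column (k + i)
  column-% k i = sym (trans (cong column eq) (column-*n (i / n) (k + i % n)))
    where
    open ≡-Reasoning
    eq : k + i ≡ i / n * n + (k + i % n)
    eq = begin
      k + i                       ≡⟨ cong (k +_) (m≡m%n+[m/n]*n i n) ⟩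
      k + (i % n + i / n * n)     ≡⟨ +-assoc k (i % n) _ ⟨
      k + i % n + i / n * n       ≡⟨ +-comm (k + i % n) _ ⟩
      i / n * n + (k + i % n)     ∎

  column-+n : ∀ i → column (i + n) ≡ column (i + 0)
  column-+n i = trans (cong column (+-comm i n)) (trans (periodic i) (cong column (sym (+-identityʳ i))))

  cls : ℕ → Class
  cls i = class (column i)

  module Dominated (listens : ∀ i r → Listens i r) where

    -- A union bound over the five columns that can reach the middle one.
    counted : ∀ i → 6 ≤ count (heard? 0 (column (2 + i))) + (count (heard? 1 (column (1 + i))) +
      (count (heard? 1 (column (3 + i))) + (count (heard? 2 (column i)) + count (heard? 2 (column (4 + i))))))
    counted i = begin
      6
        ≤⟨ count-all (λ r → c r ⊎-dec (l₁ r ⊎-dec (r₁ r ⊎-dec (l₂ r ⊎-dec r₂ r)))) (listens i) ⟩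
      count (λ r → c r ⊎-dec (l₁ r ⊎-dec (r₁ r ⊎-dec (l₂ r ⊎-dec r₂ r))))
        ≤⟨ count-⊎ c _ ⟩
      count c + count (λ r → l₁ r ⊎-dec (r₁ r ⊎-dec (l₂ r ⊎-dec r₂ r)))
        ≤⟨ +-monoʳ-≤ (count c) (count-⊎ l₁ _) ⟩
      count c + (count l₁ + count (λ r → r₁ r ⊎-dec (l₂ r ⊎-dec r₂ r)))
        ≤⟨ +-monoʳ-≤ (count c) (+-monoʳ-≤ (count l₁) (count-⊎ r₁ _)) ⟩
      count c + (count l₁ + (count r₁ + count (λ r → l₂ r ⊎-dec r₂ r)))
        ≤⟨ +-monoʳ-≤ (count c) (+-monoʳ-≤ (count l₁) (+-monoʳ-≤ (count r₁) (count-⊎ l₂ r₂))) ⟩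
      count c + (count l₁ + (count r₁ + (count l₂ + count r₂))) ∎
      where
      open ≤-Reasoning
      c  = heard? 0 (column (2 + i))
      l₁ = heard? 1 (column (1 + i))
      r₁ = heard? 1 (column (3 + i))
      l₂ = heard? 2 (column i)
      r₂ = heard? 2 (column (4 + i))

    covered : ∀ i → Covered (cls i) (cls (1 + i)) (cls (2 + i)) (cls (3 + i)) (cls (4 + i))
    covered i = ≤-trans (counted i)
      (+-mono-≤ (bound₀ (2 + i)) (+-mono-≤ (bound₁ (1 + i)) (+-mono-≤ (bound₁ (3 + i))
        (+-mono-≤ (bound₂ i) (bound₂ (4 + i))))))
      where
      bound₀ = λ i → proj₁ (count-heard (column i))
      bound₁ = λ i → proj₁ (proj₂ (count-heard (column i)))
      bound₂ = λ i → proj₂ (proj₂ (count-heard (column i)))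

    pre post : ℕ → ℕ
    pre  i = before (cls i) (cls (1 + i)) (cls (2 + i)) (cls (3 + i)) (cls (4 + i))
    post i = after  (cls i) (cls (1 + i)) (cls (2 + i)) (cls (3 + i)) (cls (4 + i))

    post≤pre : ∀ i → post i ≤ pre i
    post≤pre i = after≤before (cls i) (cls (1 + i)) (cls (2 + i)) (cls (3 + i)) (cls (4 + i)) (covered i)

    right left : ℕ → ℕ
    right i = flow (cls i) (cls (1 + i))
    left  i = flow (cls (1 + i)) (cls i)

    -- A cyclic shift only permutes the terms. Taking `h` of two neighbouring classes covers the
    -- flows in both directions and also the weights.
    ∑-periodic : (h : Class → Class → ℕ) → let g = λ i → h (cls i) (cls (1 + i)) in
      ∀ k → ∑< n (λ i → g (k + i)) ≡ ∑< n g
    ∑-periodic h zero    = refl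
    ∑-periodic h (suc k) = trans
      (trans (sum-cong-≗ {n} λ i → cong g (sym (+-suc k (toℕ i)))) (∑<-shift n (λ i → g (k + i)) per))
      (∑-periodic h k)
      where
      g = λ i → h (cls i) (cls (1 + i))
      per : g (k + n) ≡ g (k + 0)
      per = cong₂ h (cong class (column-+n k)) (cong class (column-+n (suc k)))

    total : ℕ
    total = ∑< n (λ i → toℕ (cls i))

    -- Charge handed on by one column is received by a neighbour, so the flows have the same total
    -- here as in `∑-pre`. They cancel in `n≤total`.
    ∑-post : ∑< n post ≡ 20 * n + (∑< n right + ∑< n left)
    ∑-post = begin
      ∑< n post
        ≡⟨ ∑-distrib-+ {n} (λ _ → 20) _ ⟩
      ∑< n (λ _ → 20) + ∑< n (λ i → right (1 + i) + left (2 + i))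
        ≡⟨ cong₂ _+_ (trans (sum-const n 20) (*-comm n 20)) (∑-distrib-+ {n} (λ j → right (1 + toℕ j)) _) ⟩
      20 * n + (∑< n (λ i → right (1 + i)) + ∑< n (λ i → left (2 + i)))
        ≡⟨ cong (20 * n +_) (cong₂ _+_ (∑-periodic flow 1) (∑-periodic (λ x y → flow y x) 2)) ⟩
      20 * n + (∑< n right + ∑< n left) ∎
      where open ≡-Reasoning

    ∑-pre : ∑< n pre ≡ 20 * total + (∑< n right + ∑< n left)
    ∑-pre = begin
      ∑< n pre
        ≡⟨ ∑-distrib-+ {n} (λ j → 20 * toℕ (cls (2 + toℕ j))) _ ⟩
      ∑< n (λ i → 20 * toℕ (cls (2 + i))) + ∑< n (λ i → right i + left (3 + i))
        ≡⟨ cong₂ _+_ (sum-*ˡ {n} 20 _) (∑-distrib-+ {n} (λ j → right (toℕ j)) _) ⟩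
      20 * ∑< n (λ i → toℕ (cls (2 + i))) + (∑< n right + ∑< n (λ i → left (3 + i)))
        ≡⟨ cong₂ (λ x y → 20 * x + (∑< n right + y))
             (∑-periodic (λ x _ → toℕ x) 2) (∑-periodic (λ x y → flow y x) 3) ⟩
      20 * total + (∑< n right + ∑< n left) ∎
      where open ≡-Reasoning

    total≤weight : total ≤ ∑< n (λ i → weight (column i))
    total≤weight = sum-mono-≤ {n} λ j → class≤weight (column (toℕ j))

    n≤total : n ≤ total
    n≤total = *-cancelˡ-≤ 20 (+-cancelʳ-≤ (∑< n right + ∑< n left) _ _
      (subst₂ _≤_ ∑-post ∑-pre (sum-mono-≤ {n} λ j → post≤pre (toℕ j))))

    -- The equality case

    module Tight (tight : ∑< n (λ i → weight (column i)) ≤ n) where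

      Two : ℕ → Set
      Two i = cls i ≡ # 2

      Nil : ℕ → Set
      Nil i = cls i ≡ # 0

      Alternates : ℕ → Set
      Alternates i = (Two i × Nil (1 + i) × Two (2 + i) × Nil (3 + i) × Two (4 + i)) ⊎
                     (Nil i × Two (1 + i) × Nil (2 + i) × Two (3 + i) × Nil (4 + i))

      -- A total weight of at most `n` forces the sums of `pre` and `post` to agree, hence all their
      -- terms. The tightness lemma speaks of indices below `n`; periodicity extends it to every
      -- `i`.
      pre≤post : ∀ i → pre i ≤ post i
      pre≤post i = subst₂ _≤_ (per before) (per after) (sum-mono-tight (λ j → post≤pre (toℕ j)) le (i mod n))
        where
        le : ∑< n pre ≤ ∑< n post
        le = subst₂ _≤_ (sym ∑-pre) (sym ∑-post)
          (+-monoˡ-≤ (∑< n right + ∑< n left) (*-monoʳ-≤ 20 (≤-trans total≤weight tight)))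
        eq : ∀ k → cls (k + toℕ (i mod n)) ≡ cls (k + i)
        eq k = cong class (trans (cong (λ j → column (k + j)) (toℕ-fromℕ< _)) (column-% k i))
        per : (h : (p q r s t : Class) → ℕ) →
          let g = λ i → h (cls i) (cls (1 + i)) (cls (2 + i)) (cls (3 + i)) (cls (4 + i)) in g (toℕ (i mod n)) ≡ g i
        per h rewrite eq 0 | eq 1 | eq 2 | eq 3 | eq 4 = refl

      alternates : ∀ i → Alternates i
      alternates i = [ (λ lt → contradiction (pre≤post i) (<⇒≱ lt)) , id ]′
        (discharge (cls i) (cls (1 + i)) (cls (2 + i)) (cls (3 + i)) (cls (4 + i)) (covered i))

      clash : ∀ i {A : Set} → Nil i → Two i → A
      clash i nil two = contradiction (trans (sym two) nil) λ ()

      two⇒nil : ∀ i → Two i → Nil (1 + i)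
      two⇒nil i two = [ proj₁ ∘ proj₂ , (λ alt → clash i (proj₁ alt) two) ]′ (alternates i)

      nil⇒two : ∀ i → Nil i → Two (1 + i)
      nil⇒two i nil = [ (λ alt → clash i nil (proj₁ alt)) , proj₁ ∘ proj₂ ]′ (alternates i)

      -- The listener is in column `2 + i`. By alternation the columns `i`, `2 + i` and `4 + i` are
      -- all empty and transmit nothing.
      between : ∀ i → Nil i → ∀ r → Heard 1 (column (1 + i)) r ⊎ Heard 1 (column (3 + i)) r
      between i nil r = go (listens i r)
        where
        deaf : ∀ j d → Nil j → ¬ Heard d (column j) r
        deaf j d nil h = class-0-deaf (column j) nil r (heard-mono {0} {d} {column j} {r} z≤n h)
        nil₂ : Nil (2 + i)
        nil₂ = two⇒nil (1 + i) (nil⇒two i nil)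
        nil₄ : Nil (4 + i)
        nil₄ = two⇒nil (3 + i) (nil⇒two (2 + i) nil₂)
        go : Listens i r → Heard 1 (column (1 + i)) r ⊎ Heard 1 (column (3 + i)) r
        go (inj₁ h)                      = contradiction h (deaf (2 + i) 0 nil₂)
        go (inj₂ (inj₁ h))               = inj₁ h
        go (inj₂ (inj₂ (inj₁ h)))        = inj₂ h
        go (inj₂ (inj₂ (inj₂ (inj₁ h)))) = contradiction h (deaf i 2 nil)
        go (inj₂ (inj₂ (inj₂ (inj₂ h)))) = contradiction h (deaf (4 + i) 2 nil₄)

      -- The index is that of the empty column just before the 2.
      At : Row → ℕ → Set
      At r i = Nil i × lookup (column (1 + i)) r ≡ # 2

      -- The 2 in row `r` leaves three consecutive rows of the next empty column unheard. The
      -- following column must reach all three, which places its 2 in the middle one, opposite to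
      -- `r`.
      at-2+ : ∀ r i → At r i → At (rotate 3 r) (2 + i)
      at-2+ r i (nil , two) = nil₂ ,
        heard-from-middle (column (3 + i)) (nil⇒two (2 + i) nil₂) r
          (other (rotate 2 r) (proj₁ silent))
          (other (rotate 3 r) (proj₁ (proj₂ silent)))
          (other (rotate 4 r) (proj₁ (proj₂ (proj₂ silent))))
        where
        silent = unheard-opposite (column (1 + i)) (nil⇒two i nil) r two
        nil₂ : Nil (2 + i)
        nil₂ = two⇒nil (1 + i) (nil⇒two i nil)
        other : ∀ s → ¬ Heard 1 (column (1 + i)) s → Heard 1 (column (3 + i)) s
        other s ¬h = [ (λ h → contradiction h ¬h) , id ]′ (between i nil s)

      -- Two steps of `at-2+` are two half-turns of C_6 and return to row `r`.
      at-*4+ : ∀ q r i → At r i → At r (q * 4 + i)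
      at-*4+ zero    r i at = at
      at-*4+ (suc q) r i at = subst (λ r → At r (suc q * 4 + i)) (rotate-3-involutive r)
        (at-2+ (rotate 3 r) (2 + (q * 4 + i)) (at-2+ r (q * 4 + i) (at-*4+ q r i at)))

      at-+n : ∀ r i → At r i → At r (n + i)
      at-+n r i (nil , two) = trans (cong class (periodic i)) nil ,
        trans (cong (λ v → lookup v r) (trans (cong column (sym (+-suc n i))) (periodic (1 + i)))) two

      some-nil : ∃[ i ] Nil i
      some-nil = [ (λ { (_ , nil , _) → 1 , nil }) , (λ { (nil , _) → 0 , nil }) ]′ (alternates 0)

      some-at : ∃[ r ] ∃[ i ] At r i
      some-at = proj₁ has , i , nil , proj₂ has
        where
        i = proj₁ some-nil
        nil : Nil i
        nil = proj₂ some-nil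
        two₁ = nil⇒two i nil
        two₃ = nil⇒two (2 + i) (two⇒nil (1 + i) two₁)
        l = heard? 1 (column (1 + i))
        r = heard? 1 (column (3 + i))
        three : 3 ≤ count l
        -- The six vertices of the empty column `2 + i` are shared by two neighbours of weight 2,
        -- and the right one reaches at most three of them.
        three = +-cancelʳ-≤ 3 3 (count l) (begin
          6                           ≤⟨ count-all (λ s → l s ⊎-dec r s) (between i nil) ⟩
          count (λ s → l s ⊎-dec r s) ≤⟨ count-⊎ l r ⟩
          count l + count r           ≤⟨ +-monoʳ-≤ (count l) (proj₁ (proj₂ (count-heard (column (3 + i))))) ⟩
          count l + adj (cls (3 + i)) ≡⟨ cong (λ k → count l + adj k) two₃ ⟩
          count l + 3                 ∎)
          where open ≤-Reasoning
        has : ∃[ r ] lookup (column (1 + i)) r ≡ # 2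
        has = class-2-has-2 (column (1 + i)) two₁ three

      -- Odd shifts would make a column both empty and of weight 2. A shift by 2 would put a second
      -- 2, opposite the first, in a column with room for one.
      at-period : ∀ r j → At r j → ∀ k → k < 4 → At r (k + j) → k ≡ 0
      at-period r j at 0 _ _ = refl
      at-period r j at 1 _ at₁ = clash (1 + j) (proj₁ at₁) (nil⇒two j (proj₁ at))
      at-period r j at 2 _ at₂ = contradiction
        (trans (cong (lookup (column (3 + j))) (rotate-3-involutive r)) (proj₂ at₂))
        (proj₂ (proj₂ (proj₂ (unheard-opposite (column (3 + j)) (nil⇒two (2 + j) (proj₁ at₂))
          (rotate 3 r) (proj₂ (at-2+ r j at))))))
      at-period r j at 3 _ at₃ = clash (3 + j) (proj₁ at₃)
        (nil⇒two (2 + j) (two⇒nil (1 + j) (nil⇒two j (proj₁ at))))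
      at-period r j at (suc (suc (suc (suc _)))) (s≤s (s≤s (s≤s (s≤s ())))) _

      -- The state `At r` recurs after `n` columns by periodicity and after `n / 4 * 4` columns by
      -- `at-*4+`. The two places differ by `n % 4`.
      n%4≡0 : n % 4 ≡ 0
      n%4≡0 = at-period r j (at-*4+ (n / 4) r i at) (n % 4) (m%n<n n 4) (subst (At r) eq (at-+n r i at))
        where
        r = proj₁ some-at
        i = proj₁ (proj₂ some-at)
        at : At r i
        at = proj₂ (proj₂ some-at)
        j = n / 4 * 4 + i
        eq : n + i ≡ n % 4 + j
        eq = trans (cong (_+ i) (m≡m%n+[m/n]*n n 4)) (+-assoc (n % 4) _ i)

-- From broadcasts to periodic column sequences

module LowerBound (n : ℕ) (3≤6 : 3 ≤ 6) (3≤n : 3 ≤ n) .{{_ : NonZero n}}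
  (f : Broadcast (cycle 6 3≤6 □ cycle n 3≤n)) (f-dom : Dominating (cycle 6 3≤6 □ cycle n 3≤n) f) where

  G : Graph
  G = cycle 6 3≤6 □ cycle n 3≤n

  column : ℕ → Column
  column i = tabulate λ r → f (r , i mod n)

  column-periodic : ∀ i → column (n + i) ≡ column i
  column-periodic i = cong (λ j → tabulate λ r → f (r , j))
    (mod-cong n (trans (cong (_% n) (+-comm n i)) ([m+n]%n≡m%n i n)))

  open Columns n column column-periodic

  heard : ∀ i {r s a d} → Walk (cycle 6 3≤6) r s a → 0 < toℕ (f (s , i mod n)) →
    a + d ≤ toℕ (f (s , i mod n)) → Heard d (column i) r
  heard i {r} {s} {a} {d} w pos le rewrite sym (lookup∘tabulate (λ r → f (r , i mod n)) s) =
    s , pos , ≤-trans (+-monoˡ-≤ d (rowDist-walk {3≤6} w)) le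

  listens : ∀ i r → Listens i r
  listens i r with f-dom (r , (2 + i) mod n)
  ... | (s , v) , pos , d , (w , _) , d≤ with walk-□⁻ w
  ...   | a , b , p , q , refl =
    -- The horizontal part of the walk is at most its whole length, which is at most the broadcast
    -- value and so at most 2.
    go (around n 3≤n i q (≤-trans (≤-trans (m≤n+m b a) d≤) (≤-pred (toℕ<n (f (s , v)))))) pos d≤
    where
    go : ∀ {v b} → Around n 3≤n i v b → 0 < toℕ (f (s , v)) → a + b ≤ toℕ (f (s , v)) → Listens i r
    -- `Around` allows the horizontal length to exceed the column offset, so it is lowered to 0, 1
    -- or 2.
    go same   pos le = inj₁ (heard _ p pos (≤-trans (+-monoʳ-≤ a z≤n) le))
    go left₁  pos le = inj₂ (inj₁ (heard _ p pos (≤-trans (+-monoʳ-≤ a (s≤s z≤n)) le)))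
    go right₁ pos le = inj₂ (inj₂ (inj₁ (heard _ p pos (≤-trans (+-monoʳ-≤ a (s≤s z≤n)) le))))
    go left₂  pos le =
      inj₂ (inj₂ (inj₂ (inj₁ (heard _ p pos (≤-trans (+-monoʳ-≤ a (s≤s (s≤s z≤n))) le)))))
    go right₂ pos le =
      inj₂ (inj₂ (inj₂ (inj₂ (heard _ p pos (≤-trans (+-monoʳ-≤ a (s≤s (s≤s z≤n))) le)))))

  open Dominated listens

  cost≡ : cost G f ≡ ∑< n (λ i → weight (column i))
  cost≡ = trans (cost-□ 3≤6 3≤n f)
    (sum-cong-≗ {n} {λ j → weight (tabulate λ r → f (r , j))}
      λ j → cong (λ j → weight (tabulate λ r → f (r , j))) (sym (mod-toℕ n j)))

  n≤cost : n ≤ cost G f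
  n≤cost = ≤-trans n≤total (≤-trans total≤weight (≤-reflexive (sym cost≡)))

  cost≤n⇒n%4≡0 : cost G f ≤ n → n % 4 ≡ 0
  cost≤n⇒n%4≡0 le = Tight.n%4≡0 (≤-trans (≤-reflexive (sym cost≡)) le)

-- Upper bound

infixr 5 _▷_

_▷_ : ∀ {A : Set} {w} → Vec A w → (ℕ → A) → ℕ → A
([]      ▷ x) i       = x i
((c ∷ W) ▷ x) zero    = c
((c ∷ W) ▷ x) (suc i) = (W ▷ x) i

▷-drop : ∀ {A : Set} {w} (W : Vec A w) x i → (W ▷ x) (w + i) ≡ x i
▷-drop []      x i = refl
▷-drop (c ∷ W) x i = ▷-drop W x i

∑<-▷ : ∀ {A : Set} {w} (g : A → ℕ) (W : Vec A w) x m →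
  ∑< (w + m) (g ∘ (W ▷ x)) ≡ Vec.sum (Vec.map g W) + ∑< m (g ∘ x)
∑<-▷ g []      x m = refl
∑<-▷ g (c ∷ W) x m = trans (cong (g c +_) (∑<-▷ g W x m)) (sym (+-assoc (g c) _ _))

-- Only the columns 0, …, n may be used, so closing x up to a cycle of n columns keeps the vertex
-- dominated as soon as column n repeats column 0.
SelfHeard : (ℕ → Column) → ℕ → ℕ → Row → Set
SelfHeard x n i r = ∃[ s ] ∃[ j ] j ≤ n ×
  0 < toℕ (lookup (x j) s) × rowDist r s + ∣ i - j ∣ ≤ toℕ (lookup (x j) s)

selfHeard? : ∀ x n i r → Dec (SelfHeard x n i r)
selfHeard? x n i r = any? λ s → map′
  (λ { (j , h) → toℕ j , ≤-pred (toℕ<n j) , h })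
  (λ { (j , j≤n , h) → fromℕ< (s≤s j≤n) , subst (Sends s) (sym (toℕ-fromℕ< (s≤s j≤n))) h })
  (any? {suc n} λ j → 0 <? toℕ (lookup (x (toℕ j)) s) ×-dec
    rowDist r s + ∣ i - toℕ j ∣ ≤? toℕ (lookup (x (toℕ j)) s))
  where
  Sends : Row → ℕ → Set
  Sends s j = 0 < toℕ (lookup (x j) s) × rowDist r s + ∣ i - j ∣ ≤ toℕ (lookup (x j) s)

∅ : Column
∅ = replicate 6 (# 0)

one two : Row → Column
one r = ∅ [ r ]≔ # 1
two r = ∅ [ r ]≔ # 2

-- The block dominates itself with the help of a next column that starts like every block below.
Closed : ∀ {w} → Vec Column w → Set
Closed {w} W = ∀ (i : Fin w) r → SelfHeard (W ▷ λ _ → two (# 0)) w (toℕ i) r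

closed? : ∀ {w} (W : Vec Column w) → Dec (Closed W)
closed? {w} W = all? λ i → all? λ r → selfHeard? (W ▷ λ _ → two (# 0)) w (toℕ i) r

▷-cong-≤ : ∀ {A : Set} {w} (W : Vec A w) {x y} → x 0 ≡ y 0 →
  ∀ {j} → j ≤ w → (W ▷ x) j ≡ (W ▷ y) j
▷-cong-≤ []      eq z≤n       = eq
▷-cong-≤ (c ∷ W) eq z≤n       = refl
▷-cong-≤ (c ∷ W) eq (s≤s j≤w) = ▷-cong-≤ W eq j≤w

selfHeard-drop : ∀ {w} (W : Vec Column w) x n i r →
  SelfHeard x n i r → SelfHeard (W ▷ x) (w + n) (w + i) r
selfHeard-drop []      x n i r h = h
selfHeard-drop (c ∷ W) x n i r h with selfHeard-drop W x n i r h
... | s , j , j≤ , heard = s , suc j , s≤s j≤ , heard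

-- Inside the block `Closed` applies, because the tail starts with the column it presupposes. Beyond
-- the block the tail's own domination is shifted by `w`.
selfHeard-▷ : ∀ {w} (W : Vec Column w) x n → Closed W → x 0 ≡ two (# 0) →
  (∀ i → i < n → ∀ r → SelfHeard x n i r) → ∀ i → i < w + n → ∀ r → SelfHeard (W ▷ x) (w + n) i r
selfHeard-▷ {w} W x n closed x₀ x-heard i i<w+n r with i <? w
... | yes i<w with closed (fromℕ< i<w) r
...   | s , j , j≤w , heard = s , j , ≤-trans j≤w (m≤m+n w n) ,
  subst₂ (λ c i → 0 < toℕ (lookup c s) × rowDist r s + ∣ i - j ∣ ≤ toℕ (lookup c s))
    (▷-cong-≤ W (sym x₀) j≤w) (toℕ-fromℕ< i<w) heard
selfHeard-▷ {w} W x n closed x₀ x-heard i i<w+n r | no i≮w =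
  subst (λ i → SelfHeard (W ▷ x) (w + n) i r) i≡ (selfHeard-drop W x n (i ∸ w) r
    (x-heard (i ∸ w) (+-cancelˡ-< w _ _ (subst (_< w + n) (sym i≡) i<w+n)) r))
  where
  i≡ : w + (i ∸ w) ≡ i
  i≡ = m+[n∸m]≡n (≮⇒≥ i≮w)

block₄ : Vec Column 4
block₄ = two (# 0) ∷ ∅ ∷ two (# 3) ∷ ∅ ∷ []

-- The two adjacent 1s together cover, in their own columns and the columns beside them, what the
-- neighbouring 2s miss.
block₅ : Vec Column 5
block₅ = two (# 0) ∷ one (# 3) ∷ one (# 0) ∷ two (# 3) ∷ ∅ ∷ []

-- The first two 2s share a row; the 1 between them covers the three opposite rows of its column and
-- the opposite vertex beside each 2.
block₆ : Vec Column 6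
block₆ = two (# 0) ∷ one (# 3) ∷ two (# 0) ∷ ∅ ∷ two (# 3) ∷ ∅ ∷ []

-- One extra 2 followed by three half-periods of the staggered pattern, which restores the
-- alternation of rows.
block₇ : Vec Column 7
block₇ = two (# 0) ∷ two (# 3) ∷ ∅ ∷ two (# 0) ∷ ∅ ∷ two (# 3) ∷ ∅ ∷ []

opaque
  closed₄ : Closed block₄
  closed₄ = toWitness {a? = closed? block₄} _

  closed₅ : Closed block₅
  closed₅ = toWitness {a? = closed? block₅} _

  closed₆ : Closed block₆
  closed₆ = toWitness {a? = closed? block₆} _

  closed₇ : Closed block₇
  closed₇ = toWitness {a? = closed? block₇} _

-- Of the constant tail only column `q * 4` matters: it is the one identified with column 0 when the
-- cycle closes.
staggered : ℕ → ℕ → Column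
staggered zero    = λ _ → two (# 0)
staggered (suc q) = block₄ ▷ staggered q

staggered-first : ∀ q → staggered q 0 ≡ two (# 0)
staggered-first zero    = refl
staggered-first (suc q) = refl

staggered-last : ∀ q → staggered q (q * 4) ≡ two (# 0)
staggered-last zero    = refl
staggered-last (suc q) = staggered-last q

staggered-heard : ∀ q i → i < q * 4 → ∀ r → SelfHeard (staggered q) (q * 4) i r
staggered-heard (suc q) =
  selfHeard-▷ block₄ (staggered q) (q * 4) closed₄ (staggered-first q) (staggered-heard q)

∑<-staggered : ∀ q → ∑< (q * 4) (weight ∘ staggered q) ≡ q * 4
∑<-staggered zero    = refl
∑<-staggered (suc q) = cong (4 +_) (∑<-staggered q)

-- From column sequences back to broadcasts

opaque
  rowDist-rotation : ∀ r s → s ≡ rotate (rowDist r s) r ⊎ r ≡ rotate (rowDist r s) s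
  rowDist-rotation = toWitness {a? = all? λ r → all? λ s →
    s ≟ᶠ rotate (rowDist r s) r ⊎-dec r ≟ᶠ rotate (rowDist r s) s} _

-- The shorter arc runs forwards either from `r` or from `s`; in the second case the walk is
-- reversed.
row-walk : ∀ (3≤6 : 3 ≤ 6) r s → Walk (cycle 6 3≤6) r s (rowDist r s)
row-walk 3≤6 r s with rowDist-rotation r s
... | inj₁ eq = subst₂ (λ u v → Walk (cycle 6 3≤6) u v (rowDist r s)) (mod-toℕ 6 r) (sym eq)
  (walk-mod 6 3≤6 (toℕ r) (rowDist r s))
... | inj₂ eq = walk-reverse
  (subst₂ (λ u v → Walk (cycle 6 3≤6) u v (rowDist r s)) (mod-toℕ 6 s) (sym eq)
    (walk-mod 6 3≤6 (toℕ s) (rowDist r s)))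

module _ (n : ℕ) (3≤n : 3 ≤ n) .{{_ : NonZero n}} where

  walk-mod-≤ : ∀ {i j} → i ≤ j → Walk (cycle n 3≤n) (i mod n) (j mod n) (j ∸ i)
  walk-mod-≤ {i} {j} i≤j =
    subst (λ k → Walk (cycle n 3≤n) (i mod n) (k mod n) (j ∸ i)) (m∸n+n≡m i≤j)
    (walk-mod n 3≤n i (j ∸ i))

  walk-mod-∣-∣ : ∀ i j → Walk (cycle n 3≤n) (i mod n) (j mod n) ∣ i - j ∣
  walk-mod-∣-∣ i j with ≤-total i j
  ... | inj₁ i≤j = subst (Walk _ _ _) (sym (m≤n⇒∣m-n∣≡n∸m i≤j)) (walk-mod-≤ i≤j)
  ... | inj₂ j≤i = subst (Walk _ _ _) (sym (m≤n⇒∣n-m∣≡n∸m j≤i)) (walk-reverse (walk-mod-≤ j≤i))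

adjacent? : ∀ {n} (i j : Fin n) → Dec (SymClosure Next i j)
adjacent? i j = map′ [ fwd , bwd ]′ (λ { (fwd p) → inj₁ p ; (bwd p) → inj₂ p })
  (next? i j ⊎-dec next? j i)

module UpperBound (n : ℕ) (3≤6 : 3 ≤ 6) (3≤n : 3 ≤ n) .{{_ : NonZero n}}
  (x : ℕ → Column) (x-periodic : x n ≡ x 0) (x-heard : ∀ i → i < n → ∀ r → SelfHeard x n i r) where

  G : Graph
  G = cycle 6 3≤6 □ cycle n 3≤n

  f : Broadcast G
  f (r , i) = lookup (x (toℕ i)) r

  _≟ᵛ_ : (u v : Graph.V G) → Dec (u ≡ v)
  (r , i) ≟ᵛ (s , j) = map′ (λ { (refl , refl) → refl }) (λ { refl → refl , refl }) (r ≟ᶠ s ×-dec i ≟ᶠ j)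

  _~?_ : (u v : Graph.V G) → Dec (Graph._~_ G u v)
  (r , i) ~? (s , j) = (r ≟ᶠ s ×-dec adjacent? i j) ⊎-dec (adjacent? r s ×-dec i ≟ᶠ j)

  f-mod : ∀ j → j ≤ n → ∀ s → f (s , j mod n) ≡ lookup (x j) s
  f-mod j j≤n s = cong (λ c → lookup c s) (trans (cong x (toℕ-fromℕ< _)) wrapped)
    where
    wrapped : x (j % n) ≡ x j
    wrapped with m≤n⇒m<n∨m≡n j≤n
    ... | inj₁ j<n  = cong x (m<n⇒m%n≡m j<n)
    -- Column `n` wraps around to column 0; periodicity of `x` is what makes this harmless.
    ... | inj₂ refl = trans (cong x (n%n≡0 n)) (sym x-periodic)

  dominating : Dominating G f
  dominating (r , i) with x-heard (toℕ i) (toℕ<n i) r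
  ... | s , j , j≤n , pos , le = (s , j mod n) , subst (0 <_) p≡ pos ,
    proj₁ near , proj₁ (proj₂ near) , ≤-trans (proj₂ (proj₂ near)) (subst (_ ≤_) p≡ le)
    where
    p≡ : toℕ (lookup (x j) s) ≡ toℕ (f (s , j mod n))
    p≡ = cong toℕ (sym (f-mod j j≤n s))
    walk : Walk G (r , i) (s , j mod n) (rowDist r s + ∣ toℕ i - j ∣)
    walk = walk-□ (row-walk 3≤6 r s)
      (subst (λ k → Walk (cycle n 3≤n) k (j mod n) ∣ toℕ i - j ∣) (mod-toℕ n i)
        (walk-mod-∣-∣ n 3≤n (toℕ i) j))
    near = distance-≤2 _≟ᵛ_ _~?_ walk (≤-trans le (≤-pred (toℕ<n (lookup (x j) s))))

  cost-f : cost G f ≡ ∑< n (weight ∘ x)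
  cost-f = cost-□ 3≤6 3≤n f

-- Broadcasts for each residue of `n` modulo 4

-- One irregular block followed by `q` periods. `W` may be empty, which serves the case 4 ∣ `n`;
-- hence the condition on the first column is stated through `▷`.
block-broadcast : ∀ (3≤6 : 3 ≤ 6) {w} (W : Vec Column w) → Closed W →
  (W ▷ λ _ → two (# 0)) 0 ≡ two (# 0) →
  ∀ q (3≤n : 3 ≤ w + q * 4) → let G = cycle 6 3≤6 □ cycle (w + q * 4) 3≤n in
  ∃[ f ] (Dominating G f × cost G f ≡ Vec.sum (Vec.map weight W) + q * 4)
block-broadcast 3≤6 {w} W closed first q 3≤n = f , dominating , (begin
  cost G f                             ≡⟨ cost-f ⟩
  ∑< (w + q * 4) (weight ∘ x)          ≡⟨ ∑<-▷ weight W (staggered q) (q * 4) ⟩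
  Vec.sum (Vec.map weight W) + ∑< (q * 4) (weight ∘ staggered q)
    ≡⟨ cong (Vec.sum (Vec.map weight W) +_) (∑<-staggered q) ⟩
  Vec.sum (Vec.map weight W) + q * 4   ∎)
  where
  open ≡-Reasoning
  instance
    n≢0 : NonZero (w + q * 4)
    n≢0 = >-nonZero (≤-trans (s≤s z≤n) 3≤n)
  x : ℕ → Column
  x = W ▷ staggered q
  x-closes : x (w + q * 4) ≡ x 0
  x-closes = begin
    x (w + q * 4)               ≡⟨ ▷-drop W (staggered q) (q * 4) ⟩
    staggered q (q * 4)         ≡⟨ staggered-last q ⟩
    two (# 0)                   ≡⟨ first ⟨
    (W ▷ λ _ → two (# 0)) 0     ≡⟨ ▷-cong-≤ W (sym (staggered-first q)) z≤n ⟩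
    x 0                         ∎
  open UpperBound (w + q * 4) 3≤6 3≤n x x-closes
    (selfHeard-▷ W (staggered q) (q * 4) closed (staggered-first q) (staggered-heard q))

optimal-broadcast : ∀ n (3≤6 : 3 ≤ 6) (3≤n : 3 ≤ n) → 6 ≤ n → let G = cycle 6 3≤6 □ cycle n 3≤n in
  ∃[ f ] (Dominating G f × cost G f ≡ n + (if n % 4 ≡ᵇ 0 then 0 else 1))
optimal-broadcast n 3≤6 = go (n % 4) (n / 4) (m%n<n n 4) (m≡m%n+[m/n]*n n 4)
  where
  Goal : ℕ → ℕ → Set
  Goal n c = (3≤n : 3 ≤ n) → 6 ≤ n → let G = cycle 6 3≤6 □ cycle n 3≤n in
    ∃[ f ] (Dominating G f × cost G f ≡ n + c)
  with-cost : ∀ {n c c′} (3≤n : 3 ≤ n) → c ≡ c′ → let G = cycle 6 3≤6 □ cycle n 3≤n in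
    ∃[ f ] (Dominating G f × cost G f ≡ c) → ∃[ f ] (Dominating G f × cost G f ≡ c′)
  with-cost _ refl p = p
  by-residue : ∀ ρ q → ρ < 4 → Goal (ρ + q * 4) (if ρ ≡ᵇ 0 then 0 else 1)
  by-residue 0 q _ 3≤n _ = with-cost 3≤n (sym (+-identityʳ (q * 4)))
    (block-broadcast 3≤6 [] (λ ()) refl q 3≤n)
  -- For a nonzero residue the block has `4 + ρ` columns and so absorbs one period. The remaining
  -- cases with `q` equal to 0 contradict 6 ≤ `n`.
  by-residue 1 (suc q) _ 3≤n _ = with-cost 3≤n (+-comm 1 (5 + q * 4))
    (block-broadcast 3≤6 block₅ closed₅ refl q 3≤n)
  by-residue 2 (suc q) _ 3≤n _ = with-cost 3≤n (+-comm 1 (6 + q * 4))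
    (block-broadcast 3≤6 block₆ closed₆ refl q 3≤n)
  by-residue 3 (suc q) _ 3≤n _ = with-cost 3≤n (+-comm 1 (7 + q * 4))
    (block-broadcast 3≤6 block₇ closed₇ refl q 3≤n)
  by-residue 1 0 _ _ (s≤s ())
  by-residue 2 0 _ _ (s≤s (s≤s ()))
  by-residue 3 0 _ _ (s≤s (s≤s (s≤s ())))
  by-residue (suc (suc (suc (suc _)))) _ (s≤s (s≤s (s≤s (s≤s ()))))
  go : ∀ ρ q → ρ < 4 → n ≡ ρ + q * 4 → Goal n (if ρ ≡ᵇ 0 then 0 else 1)
  go ρ q ρ<4 refl = by-residue ρ q ρ<4

+-indicator-≤ : ∀ {n c} ρ → n ≤ c → (c ≤ n → ρ ≡ 0) → n + (if ρ ≡ᵇ 0 then 0 else 1) ≤ c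
+-indicator-≤ {n} 0       n≤c _ = ≤-trans (≤-reflexive (+-identityʳ n)) n≤c
+-indicator-≤ {n} (suc ρ) n≤c p = ≤-trans (≤-reflexive (+-comm n 1)) (≰⇒> λ c≤n → 1+n≢0 (p c≤n))

theorem4p7 : (n : ℕ) (6≤n : 6 ≤ n) →
    Is2LimitedBroadcastNumber (cycle 6 (m≤m+n 3 3) □ cycle n (≤-trans (m≤m+n 3 3) 6≤n))
      (n + (if n % 4 ≡ᵇ 0 then 0 else 1))
theorem4p7 n 6≤n = optimal-broadcast n (m≤m+n 3 3) 3≤n 6≤n , λ where
    _ (f , f-dom , refl) → let open LowerBound n (m≤m+n 3 3) 3≤n f f-dom in
      +-indicator-≤ (n % 4) n≤cost cost≤n⇒n%4≡0
  where
  3≤n : 3 ≤ n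
  3≤n = ≤-trans (m≤m+n 3 3) 6≤n
  instance
    n≢0 : NonZero n
    n≢0 = >-nonZero (≤-trans (s≤s z≤n) 6≤n)
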